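{- Let $n\ge k\ge 1$ and let $\lambda=(\lambda_1,\ldots,\lambda_k)$ be a partition with $\lambda_1\ge\lambda_2\ge\cdots\ge\lambda_k\ge 0$ and $\lambda_1\le n-k$, and set $\lambda_{k+1}:=0$. Then the weight generating function $P_\lambda(\alpha,\beta)=\sum_T \mathrm{wt}(T)$, summed over all Condensed Catalan tableaux $T$ of size $(k,n)$ and shape $\lambda$, equals $$P_\lambda(\alpha,\beta)=\alpha^k\beta^{n-k}\det\big(A_{ij}\big)_{1\le i,j\le k},$$ where $$A_{ij}=\beta^{j-i}\alpha^{\lambda_i-\lambda_{j+1}}\left(\binom{\lambda_{j+1}}{j-i}+\beta\binom{\lambda_{j+1}}{j-i+1}\right)+\beta^{j-i}\alpha^{\lambda_i-\lambda_j}\sum_{\ell=0}^{\lambda_j-\lambda_{j+1}-1}\alpha^{\ell}\left(\binom{\lambda_j-\ell-1}{j-i-1}+\beta\binom{\lambda_j-\ell-1}{j-i}\right).$$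
   Context: Binomial coefficients $\binom{a}{b}$ (here always with $a\ge 0$) are $0$ when $b<0$ or $b>a$; an empty sum is $0$. The Young diagram of $\lambda$ (English convention) consists of boxes $(r,c)$ with $1\le r\le k$, $1\le c\le\lambda_r$ (row 1 on top, column 1 leftmost), viewed inside a $k\times(n-k)$ rectangle. A Condensed Catalan tableau of size $(k,n)$ and shape $\lambda$ is an assignment to each box of one of $\alpha$, $\beta$, or empty, such that: (ii) if box $(r,c)$ contains $\beta$, every box $(r,c')$ with $c'<c$ is empty; (iii) if box $(r,c)$ contains $\alpha$, every box $(r',c)$ with $r'<r$ is empty; (iv) every box $(r,c)$ such that there is no $\alpha$ in any box $(r',c)$ with $r'>r$ and no $\beta$ in any box $(r,c')$ with $c'>c$ contains $\alpha$ or $\beta$. Its weight is $\mathrm{wt}(T)=\alpha^{k+a}\beta^{n-k+b}$, where $a$ and $b$ are the numbers of $\alpha$'s and $\beta$'s in the filling. -}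

module Defs where

open import Algebra.Bundles using (CommutativeRing)
import Algebra.Definitions as AlgDef
import Algebra.Properties.Monoid.Sum as MonoidSum
import Algebra.Properties.Semiring.Exp as SemiringExp
import Algebra.Properties.Semiring.Mult as SemiringMult
open import Data.Fin.Base as Fin using (Fin; zero; suc; toℕ; punchIn)
import Data.Fin.Properties as Fin
open import Data.Integer.Base as ℤ using (ℤ; -[1+_]; _⊖_)
open import Data.List.Base as List using (List; []; _∷_; cartesianProductWith; filter)
open import Data.List.Membership.Propositional using (_∈_)
open import Data.List.Membership.Propositional.Properties using (∈-cartesianProductWith⁺)
import Data.List.Relation.Unary.All as ListAll
import Data.List.Relation.Unary.AllPairs as AllPairs
open import Data.List.Relation.Unary.Any using (here; there)
open import Data.List.Relation.Unary.Unique.Propositional using (Unique)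
open import Data.List.Relation.Unary.Unique.Propositional.Properties using (cartesianProductWith⁺)
open import Data.Nat.Base as ℕ using (ℕ; zero; suc; _∸_)
open import Data.Nat.Combinatorics using (_C_)
import Data.Nat.Properties as ℕ
open import Data.Product.Base using (_×_; _,_)
open import Data.Sum.Base using (_⊎_)
open import Data.Vec.Base as Vec using (Vec; []; _∷_)
open import Data.Vec.Relation.Unary.All using (All; []; _∷_)
open import Level using (Level)
open import Relation.Binary.Definitions using (DecidableEquality)
open import Relation.Binary.PropositionalEquality.Core using (_≡_; _≢_; refl)
open import Relation.Nullary.Decidable.Core using (Dec; yes; no; _×-dec_; _⊎-dec_; _→-dec_; ¬?)

private
  variable
    k m : ℕ

-- A partition (λ₁ ≥ … ≥ λₖ ≥ 0) is a vector μ of length k.  Indices start at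
-- 0, so part μ i is λᵢ₊₁; it is 0 past the end, in particular λₖ₊₁ = 0.

part : Vec ℕ k → ℕ → ℕ
part []      _       = 0
part (x ∷ _) zero    = x
part (_ ∷ μ) (suc i) = part μ i

data Entry : Set where
  blank αᵉ βᵉ : Entry

_≟ᵉ_ : DecidableEquality Entry
blank ≟ᵉ blank = yes refl
blank ≟ᵉ αᵉ    = no λ ()
blank ≟ᵉ βᵉ    = no λ ()
αᵉ    ≟ᵉ blank = no λ ()
αᵉ    ≟ᵉ αᵉ    = yes refl
αᵉ    ≟ᵉ βᵉ    = no λ ()
βᵉ    ≟ᵉ blank = no λ ()
βᵉ    ≟ᵉ αᵉ    = no λ ()
βᵉ    ≟ᵉ βᵉ    = yes refl

-- One row of entries for each part of μ.

Filling : Vec ℕ k → Set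
Filling μ = All (Vec Entry) μ

entry : {μ : Vec ℕ k} → Filling μ → (r : Fin k) → Fin (Vec.lookup μ r) → Entry
entry (row ∷ _) zero    c = Vec.lookup row c
entry (_ ∷ T)   (suc r) c = entry T r c

count : Entry → {μ : Vec ℕ k} → Filling μ → ℕ
count e []        = 0
count e (row ∷ T) = Vec.count (e ≟ᵉ_) row ℕ.+ count e T

-- Boxes (r , c) and (r′ , c′) in different rows have column indices in
-- different Fin types; they are in the same column when toℕ c′ ≡ toℕ c.

module _ {μ : Vec ℕ k} (T : Filling μ) where

  EmptyLeftOfβ : Set
  EmptyLeftOfβ = ∀ r c → entry T r c ≡ βᵉ →
    ∀ c′ → c′ Fin.< c → entry T r c′ ≡ blank

  EmptyAboveα : Set
  EmptyAboveα = ∀ r c → entry T r c ≡ αᵉ →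
    ∀ r′ c′ → r′ Fin.< r → toℕ c′ ≡ toℕ c → entry T r′ c′ ≡ blank

  FilledWhenFree : Set
  FilledWhenFree = ∀ r c →
    (∀ r′ c′ → r Fin.< r′ → toℕ c′ ≡ toℕ c → entry T r′ c′ ≢ αᵉ) →
    (∀ c′ → c Fin.< c′ → entry T r c′ ≢ βᵉ) →
    entry T r c ≡ αᵉ ⊎ entry T r c ≡ βᵉ

  IsCondensedCatalan : Set
  IsCondensedCatalan = EmptyLeftOfβ × EmptyAboveα × FilledWhenFree

  isCondensedCatalan? : Dec IsCondensedCatalan
  isCondensedCatalan? =
    (Fin.all? λ r → Fin.all? λ c → (entry T r c ≟ᵉ βᵉ) →-dec
       Fin.all? λ c′ → (c′ Fin.<? c) →-dec (entry T r c′ ≟ᵉ blank))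
    ×-dec
    (Fin.all? λ r → Fin.all? λ c → (entry T r c ≟ᵉ αᵉ) →-dec
       Fin.all? λ r′ → Fin.all? λ c′ → (r′ Fin.<? r) →-dec
         ((toℕ c′ ℕ.≟ toℕ c) →-dec (entry T r′ c′ ≟ᵉ blank)))
    ×-dec
    (Fin.all? λ r → Fin.all? λ c →
       (Fin.all? λ r′ → Fin.all? λ c′ → (r Fin.<? r′) →-dec
         ((toℕ c′ ℕ.≟ toℕ c) →-dec ¬? (entry T r′ c′ ≟ᵉ αᵉ)))
       →-dec
       ((Fin.all? λ c′ → (c Fin.<? c′) →-dec ¬? (entry T r c′ ≟ᵉ βᵉ))
       →-dec
       ((entry T r c ≟ᵉ αᵉ) ⊎-dec (entry T r c ≟ᵉ βᵉ))))

entries : List Entry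
entries = blank ∷ αᵉ ∷ βᵉ ∷ []

rows : (m : ℕ) → List (Vec Entry m)
rows zero    = [] ∷ []
rows (suc m) = cartesianProductWith _∷_ entries (rows m)

fillings : (μ : Vec ℕ k) → List (Filling μ)
fillings []      = [] ∷ []
fillings (m ∷ μ) = cartesianProductWith _∷_ (rows m) (fillings μ)

-- fillings lists every filling exactly once, so that summing over the list
-- is summing over the finite set of fillings.

private
  ∈-entries : (e : Entry) → e ∈ entries
  ∈-entries blank = here refl
  ∈-entries αᵉ    = there (here refl)
  ∈-entries βᵉ    = there (there (here refl))

  entries-unique : Unique entries
  entries-unique = ((λ ()) ListAll.∷ (λ ()) ListAll.∷ ListAll.[])
    AllPairs.∷ ((λ ()) ListAll.∷ ListAll.[])
    AllPairs.∷ ListAll.[] AllPairs.∷ AllPairs.[]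

  ∈-rows : (row : Vec Entry m) → row ∈ rows m
  ∈-rows []        = here refl
  ∈-rows (e ∷ row) = ∈-cartesianProductWith⁺ _∷_ (∈-entries e) (∈-rows row)

  rows-unique : ∀ m → Unique (rows m)
  rows-unique zero    = ListAll.[] AllPairs.∷ AllPairs.[]
  rows-unique (suc m) = cartesianProductWith⁺ _∷_ (λ { refl → refl , refl })
    entries-unique (rows-unique m)

∈-fillings : {μ : Vec ℕ k} (T : Filling μ) → T ∈ fillings μ
∈-fillings []        = here refl
∈-fillings (row ∷ T) = ∈-cartesianProductWith⁺ _∷_ (∈-rows row) (∈-fillings T)

fillings-unique : (μ : Vec ℕ k) → Unique (fillings μ)
fillings-unique []      = ListAll.[] AllPairs.∷ AllPairs.[]
fillings-unique (m ∷ μ) = cartesianProductWith⁺ _∷_ (λ { refl → refl , refl })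
  (rows-unique m) (fillings-unique μ)

tableaux : (μ : Vec ℕ k) → List (Filling μ)
tableaux μ = filter isCondensedCatalan? (fillings μ)

binomial : ℕ → ℤ → ℕ
binomial a (ℤ.+ b)  = a C b
binomial a -[1+ _ ] = 0

-- The indeterminates α and β are read as arbitrary elements of an arbitrary
-- commutative ring.  The matrix A is written with negative powers, so there
-- α and β are units; ℤ[α^±1, β^±1] with its two variables is one instance.

module Over {c ℓ : Level} (R : CommutativeRing c ℓ) where

  open CommutativeRing R using (Carrier; _≈_; _+_; _*_; -_; 0#; 1#; +-monoid; semiring)
  open AlgDef _≈_ using (Invertible)
  open MonoidSum +-monoid using (sum)
  open SemiringExp semiring public using (_^_)
  open SemiringMult semiring using () renaming (_×_ to _·_)

  Unit : Carrier → Set _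
  Unit x = Invertible 1# _*_ x

  zpow : {x : Carrier} → Unit x → ℤ → Carrier
  zpow {x} _         (ℤ.+ n)  = x ^ n
  zpow     (x⁻¹ , _) -[1+ n ] = x⁻¹ ^ suc n

  Matrix : ℕ → Set _
  Matrix k = Fin k → Fin k → Carrier

  -- Cofactor expansion along the first column.

  det : Matrix k → Carrier
  det {zero}  M = 1#
  det {suc k} M = sum λ i →
    (- 1#) ^ toℕ i * M i zero * det λ r s → M (punchIn i r) (suc s)

  weight : (n : ℕ) {μ : Vec ℕ k} → Carrier → Carrier → Filling μ → Carrier
  weight {k} n α β T = α ^ (k ℕ.+ count αᵉ T) * β ^ ((n ∸ k) ℕ.+ count βᵉ T)

  P : (n : ℕ) → Vec ℕ k → Carrier → Carrier → Carrier
  P n μ α β = List.foldr _+_ 0# (List.map (weight n α β) (tableaux μ))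

  bin : ℕ → ℤ → Carrier
  bin a b = binomial a b · 1#

  -- i ⊖ j is the integer difference of two naturals.  The truncated
  -- subtractions are exact for weakly decreasing μ, because l < λⱼ − λⱼ₊₁.
  -- If λⱼ = λⱼ₊₁ the inner sum is empty.

  A : Vec ℕ k → {α β : Carrier} → Unit α → Unit β → Matrix k
  A μ {β = β} α-unit β-unit i′ j′ =
      zpow β-unit (j ⊖ i) * zpow α-unit (λᵢ ⊖ λⱼ₊₁)
        * (bin λⱼ₊₁ (j ⊖ i) + β * bin λⱼ₊₁ (ℤ.suc (j ⊖ i)))
    + zpow β-unit (j ⊖ i) * zpow α-unit (λᵢ ⊖ λⱼ)
        * sum {λⱼ ∸ λⱼ₊₁} (λ l → zpow α-unit (ℤ.+ toℕ l)
            * ( bin (λⱼ ∸ toℕ l ∸ 1) (ℤ.pred (j ⊖ i))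
              + β * bin (λⱼ ∸ toℕ l ∸ 1) (j ⊖ i)))
    where
    i j λᵢ λⱼ λⱼ₊₁ : ℕ
    i = toℕ i′
    j = toℕ j′
    λᵢ = part μ i
    λⱼ = part μ j
    λⱼ₊₁ = part μ (suc j)

{-# OPTIONS --safe #-}

-- Filling rows from bottom to top and boxes from right to left, a box is filled iff
-- its column holds no α so far and its row no β so far.  Hence the sum over the
-- fillings of a row depends only on the number m of live columns it meets, and the
-- generating function S p m of p equal rows satisfies
--   S (p + 1) (m + 1) = β S p (m + 1) + α S (p + 1) m.
-- The same recursion governs p rows of length m put on top of a partition μ, m ≥ μ₁,
-- so that α⁻ᵘ S is a discrete antiderivative in u, piece by piece.  Expanding it at
-- u = 0 by the Taylor formula writes Z(λ₁, …, λₖ) as an alternating combination of the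
-- Z(λⱼ₊₁, …, λₖ), whose coefficients turn out to be the first row of A.  Since A is
-- Hessenberg with subdiagonal 1, this is the recursion satisfied by its determinant.

module Submission where

open import Defs
open import Algebra.Bundles using (CommutativeRing)
open import Data.Nat.Base using (ℕ; _≤_; _≥_; _∸_)
open import Data.Vec.Base using (Vec)
open import Data.Vec.Relation.Unary.Linked using (Linked)

import Algebra.Properties.CommutativeSemiring.Exp as CommutativeSemiringExp
import Algebra.Properties.Monoid.Sum as MonoidSum
import Algebra.Properties.Semiring.Exp as SemiringExp
import Algebra.Properties.Semiring.Mult as SemiringMult
import Algebra.Properties.Semiring.Sum as SemiringSum
import Algebra.Solver.Ring.NaturalCoefficients.Default as NaturalCoefficients
open import Data.Bool.Base using (Bool; true; false; _∧_; not; if_then_else_)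
open import Data.Empty using (⊥-elim)
open import Data.Fin.Base as Fin using (Fin; zero; suc; toℕ; punchIn)
open import Data.Integer.Base as ℤ using (_⊖_)
import Data.Integer.Properties as ℤ
open import Data.List.Base as List using (List; []; _∷_; _++_; cartesianProductWith; filter)
open import Data.Nat.Base as ℕ using (zero; suc; z≤n; s≤s)
open import Data.Nat.Combinatorics using (_C_; nCn≡1; nCk≡nC[n∸k]; nCk+nC[k+1]≡[n+1]C[k+1])
import Data.Nat.Properties as ℕ
open import Data.Product.Base using (_×_; _,_; proj₁; proj₂)
open import Data.Sum.Base using (_⊎_; inj₁; inj₂)
open import Data.Vec.Base as Vec using ([]; _∷_)
open import Data.Vec.Relation.Unary.All using ([]; _∷_)
open import Data.Vec.Relation.Unary.Linked as Linked using ([]; [-]; _∷_)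
open import Function.Base using (_∘_)
open import Level using (Level)
open import Relation.Binary.PropositionalEquality.Core as ≡ using (_≡_; _≢_; refl)
open import Relation.Nullary.Decidable.Core using (yes; no)
open import Relation.Unary using (Pred; Decidable)

private
  variable
    k m : ℕ

-- Row by row description of condensed Catalan tableaux

head-≥ : ∀ {y} {ν : Vec ℕ k} → Linked _≥_ (y ∷ ν) → part ν 0 ≤ y
head-≥ [-]                 = z≤n
head-≥ {ν = _ ∷ _} (p ∷ _) = p

α≢blank : αᵉ ≢ blank
α≢blank ()

β≢blank : βᵉ ≢ blank
β≢blank ()

isBlank : Entry → Bool
isBlank blank = true
isBlank αᵉ    = false
isBlank βᵉ    = false

-- Columns are natural numbers, and a row counts as free of α past its end, so that rows of
-- different lengths can be compared.
notα : Vec Entry m → ℕ → Bool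
notα []           _       = true
notα (blank ∷ _)  zero    = true
notα (αᵉ ∷ _)     zero    = false
notα (βᵉ ∷ _)     zero    = true
notα (_ ∷ row)    (suc c) = notα row c

hasβ : Vec Entry m → Bool
hasβ []            = false
hasβ (blank ∷ row) = hasβ row
hasβ (αᵉ ∷ row)    = hasβ row
hasβ (βᵉ ∷ row)    = true

fits : (free : Bool) → Entry → Bool
fits true  e = not (isBlank e)
fits false e = isBlank e

-- The columns of a row are given by the function live that says which of them
-- contain no α in a lower row.
fitsRow : (live : ℕ → Bool) → Vec Entry m → Bool
fitsRow live []        = true
fitsRow live (e ∷ row) = fits (live 0 ∧ not (hasβ row)) e ∧ fitsRow (live ∘ suc) row

alive : {μ : Vec ℕ k} → Filling μ → ℕ → Bool
alive []        c = true
alive (row ∷ T) c = alive T c ∧ notα row c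

good : {μ : Vec ℕ k} → Filling μ → Bool
good []        = true
good (row ∷ T) = good T ∧ fitsRow (alive T) row

countTrue : (ℕ → Bool) → ℕ → ℕ
countTrue live zero    = 0
countTrue live (suc m) = (if live 0 then suc else λ n → n) (countTrue (live ∘ suc) m)

∧-true : ∀ {x y} → x ∧ y ≡ true → x ≡ true × y ≡ true
∧-true {true} {true} _ = refl , refl

∧-intro : ∀ {x y} → x ≡ true → y ≡ true → x ∧ y ≡ true
∧-intro refl refl = refl

notα-sound : (row : Vec Entry m) (c : Fin m) → notα row (toℕ c) ≡ true → Vec.lookup row c ≢ αᵉ
notα-sound (αᵉ ∷ row)    zero    () eq
notα-sound (blank ∷ row) (suc c) t  eq = notα-sound row c t eq
notα-sound (αᵉ ∷ row)    (suc c) t  eq = notα-sound row c t eq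
notα-sound (βᵉ ∷ row)    (suc c) t  eq = notα-sound row c t eq

notα-complete : (row : Vec Entry m) (c : ℕ) →
  (∀ c′ → toℕ c′ ≡ c → Vec.lookup row c′ ≢ αᵉ) → notα row c ≡ true
notα-complete []            c       f = refl
notα-complete (blank ∷ row) zero    f = refl
notα-complete (αᵉ ∷ row)    zero    f = ⊥-elim (f zero refl refl)
notα-complete (βᵉ ∷ row)    zero    f = refl
notα-complete (blank ∷ row) (suc c) f = notα-complete row c λ c′ eq → f (suc c′) (≡.cong suc eq)
notα-complete (αᵉ ∷ row)    (suc c) f = notα-complete row c λ c′ eq → f (suc c′) (≡.cong suc eq)
notα-complete (βᵉ ∷ row)    (suc c) f = notα-complete row c λ c′ eq → f (suc c′) (≡.cong suc eq)

notα-beyond : (row : Vec Entry m) (c : ℕ) → m ≤ c → notα row c ≡ true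
notα-beyond []            c       _       = refl
notα-beyond (blank ∷ row) (suc c) (s≤s p) = notα-beyond row c p
notα-beyond (αᵉ ∷ row)    (suc c) (s≤s p) = notα-beyond row c p
notα-beyond (βᵉ ∷ row)    (suc c) (s≤s p) = notα-beyond row c p

hasβ-sound : (row : Vec Entry m) → hasβ row ≡ false → ∀ c → Vec.lookup row c ≢ βᵉ
hasβ-sound (βᵉ ∷ row)    ()
hasβ-sound (blank ∷ row) p (suc c) eq = hasβ-sound row p c eq
hasβ-sound (αᵉ ∷ row)    p (suc c) eq = hasβ-sound row p c eq

hasβ-complete : (row : Vec Entry m) → (∀ c → Vec.lookup row c ≢ βᵉ) → hasβ row ≡ false
hasβ-complete []            f = refl
hasβ-complete (blank ∷ row) f = hasβ-complete row (f ∘ suc)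
hasβ-complete (αᵉ ∷ row)    f = hasβ-complete row (f ∘ suc)
hasβ-complete (βᵉ ∷ row)    f = ⊥-elim (f zero refl)

alive-sound : {μ : Vec ℕ k} (T : Filling μ) (c : ℕ) → alive T c ≡ true →
  ∀ r c′ → toℕ c′ ≡ c → entry T r c′ ≢ αᵉ
alive-sound (row ∷ T) c t zero    c′ refl = notα-sound row c′ (proj₂ (∧-true {alive T c} t))
alive-sound (row ∷ T) c t (suc r) c′ eq   = alive-sound T c (proj₁ (∧-true t)) r c′ eq

alive-complete : {μ : Vec ℕ k} (T : Filling μ) (c : ℕ) →
  (∀ r c′ → toℕ c′ ≡ c → entry T r c′ ≢ αᵉ) → alive T c ≡ true
alive-complete []        c f = refl
alive-complete (row ∷ T) c f =
  ∧-intro (alive-complete T c (f ∘ suc)) (notα-complete row c (f zero))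

alive-beyond : {μ : Vec ℕ k} → Linked _≥_ μ → (T : Filling μ) (c : ℕ) →
  part μ 0 ≤ c → alive T c ≡ true
alive-beyond []       []              c p = refl
alive-beyond [-]      (row ∷ [])      c p = notα-beyond row c p
alive-beyond (q ∷ qs) (row ∷ T@(_ ∷ _)) c p =
  ∧-intro (alive-beyond qs T c (ℕ.≤-trans q p)) (notα-beyond row c p)

-- The three conditions seen from one row, the lower rows entering only through `live`. The
-- condition on α is read from the upper box: a box that is not blank has no α below it.
record IsRow (live : ℕ → Bool) (row : Vec Entry m) : Set where
  field
    emptyLeftOfβ : ∀ c → Vec.lookup row c ≡ βᵉ → ∀ c′ → c′ Fin.< c → Vec.lookup row c′ ≡ blank
    emptyAboveα  : ∀ c → Vec.lookup row c ≢ blank → live (toℕ c) ≡ true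
    filled       : ∀ c → live (toℕ c) ≡ true → (∀ c′ → c Fin.< c′ → Vec.lookup row c′ ≢ βᵉ) →
                   Vec.lookup row c ≢ blank

open IsRow

isRow⇒fitsRow : (live : ℕ → Bool) (row : Vec Entry m) → IsRow live row → fitsRow live row ≡ true
isRow⇒fitsRow live []        h = refl
isRow⇒fitsRow {suc m} live (e ∷ row) h =
  ∧-intro (head (live 0) (hasβ row) refl refl) (isRow⇒fitsRow (live ∘ suc) row (record
    { emptyLeftOfβ = λ c eq c′ lt → emptyLeftOfβ h (suc c) eq (suc c′) (s≤s lt)
    ; emptyAboveα  = λ c → emptyAboveα h (suc c)
    ; filled       = λ c l f → filled h (suc c) l λ { (suc c′) (s≤s lt) → f c′ lt }
    }))
  where
  mustBlank : ∀ {e} → (e ≢ blank → true ≡ false) → isBlank e ≡ true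
  mustBlank {blank} _ = refl
  mustBlank {αᵉ}    f = ≡.sym (f λ ())
  mustBlank {βᵉ}    f = ≡.sym (f λ ())

  mustFill : ∀ {e} → e ≢ blank → not (isBlank e) ≡ true
  mustFill {blank} f = ⊥-elim (f refl)
  mustFill {αᵉ}    _ = refl
  mustFill {βᵉ}    _ = refl

  -- The truth values come with equations because the fields of `h` speak of `live 0` and
  -- `hasβ row`. A dead column or a β to the right forces a blank; otherwise `filled` applies.
  head : ∀ l b → live 0 ≡ l → hasβ row ≡ b → fits (l ∧ not b) e ≡ true
  head false b     p q = mustBlank λ ne → ≡.trans (≡.sym (emptyAboveα h zero ne)) p
  head true  true  p q = mustBlank λ ne → ≡.trans (≡.sym q)
    (hasβ-complete row λ c eq → ne (emptyLeftOfβ h (suc c) eq zero (s≤s z≤n)))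
  head true  false p q = mustFill (filled h zero p λ { (suc c) _ → hasβ-sound row q c })

fitsRow⇒isRow : (live : ℕ → Bool) (row : Vec Entry m) → fitsRow live row ≡ true → IsRow live row
fitsRow⇒isRow live []        t = record { emptyLeftOfβ = λ () ; emptyAboveα = λ () ; filled = λ () }
fitsRow⇒isRow {suc m} live (e ∷ row) t = record
  { emptyLeftOfβ = λ where
      (suc c) eq zero     _        → left c eq (hasβ row) refl e (proj₁ (∧-true t))
      (suc c) eq (suc c′) (s≤s lt) → emptyLeftOfβ rest c eq c′ lt
  ; emptyAboveα = λ where
      zero    ne → above (live 0) e ne (proj₁ (∧-true t))
      (suc c) ne → emptyAboveα rest c ne
  ; filled = λ where
      zero    l f → fill l (hasβ-complete row λ c → f (suc c) (s≤s z≤n)) e (proj₁ (∧-true t))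
      (suc c) l f → filled rest c l λ c′ lt → f (suc c′) (s≤s lt)
  }
  where
  rest : IsRow (live ∘ suc) row
  rest = fitsRow⇒isRow (live ∘ suc) row (proj₂ (∧-true {fits (live 0 ∧ not (hasβ row)) e} t))

  unfree : ∀ l e → fits (l ∧ false) e ≡ true → e ≡ blank
  unfree false blank _ = refl
  unfree true  blank _ = refl
  unfree false αᵉ ()
  unfree true  αᵉ ()
  unfree false βᵉ ()
  unfree true  βᵉ ()

  left : ∀ c → Vec.lookup row c ≡ βᵉ → ∀ b → hasβ row ≡ b → ∀ e →
    fits (live 0 ∧ not b) e ≡ true → e ≡ blank
  left c eq true  q e p = unfree (live 0) e p
  left c eq false q e p = ⊥-elim (hasβ-sound row q c eq)

  above : ∀ l e → e ≢ blank → fits (l ∧ not (hasβ row)) e ≡ true → l ≡ true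
  above true  _     ne p = refl
  above false blank ne p = ⊥-elim (ne refl)

  fill : live 0 ≡ true → hasβ row ≡ false → ∀ e → fits (live 0 ∧ not (hasβ row)) e ≡ true → e ≢ blank
  fill p q e t refl rewrite p | q with () ← t

good⇒isCondensedCatalan : {μ : Vec ℕ k} (T : Filling μ) → good T ≡ true → IsCondensedCatalan T
good⇒isCondensedCatalan []        t = (λ ()) , (λ ()) , (λ ())
good⇒isCondensedCatalan (row ∷ T) t
  with goodT , fitsT ← ∧-true {good T} t
  with leftβ , aboveα , free ← good⇒isCondensedCatalan T goodT
  = (λ { zero → emptyLeftOfβ isRow ; (suc r) → leftβ r })
  , (λ { (suc r) c eq zero     c′ lt       ceq → above r c eq c′ ceq (Vec.lookup row c′) refl
       ; (suc r) c eq (suc r′) c′ (s≤s lt) ceq → aboveα r c eq r′ c′ lt ceq })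
  , (λ { zero    c nα nβ → nonblank (filled isRow c
                             (alive-complete T (toℕ c) λ r c′ → nα (suc r) c′ (s≤s z≤n)) nβ)
       ; (suc r) c nα nβ → free r c (λ r′ c′ lt → nα (suc r′) c′ (s≤s lt)) nβ })
  where
  isRow = fitsRow⇒isRow (alive T) row (proj₂ (∧-true {good T} t))

  -- An entry above an α that were not blank would lie in a live column, which that α excludes.
  above : ∀ r c → entry T r c ≡ αᵉ → ∀ c′ → toℕ c′ ≡ toℕ c → ∀ e → Vec.lookup row c′ ≡ e →
    Vec.lookup row c′ ≡ blank
  above r c eq c′ ceq blank p = p
  above r c eq c′ ceq αᵉ p = ⊥-elim (alive-sound T (toℕ c′)
    (emptyAboveα isRow c′ λ q → α≢blank (≡.trans (≡.sym p) q)) r c (≡.sym ceq) eq)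
  above r c eq c′ ceq βᵉ p = ⊥-elim (alive-sound T (toℕ c′)
    (emptyAboveα isRow c′ λ q → β≢blank (≡.trans (≡.sym p) q)) r c (≡.sym ceq) eq)

  nonblank : ∀ {e} → e ≢ blank → e ≡ αᵉ ⊎ e ≡ βᵉ
  nonblank {blank} f = ⊥-elim (f refl)
  nonblank {αᵉ}    f = inj₁ refl
  nonblank {βᵉ}    f = inj₂ refl

isCondensedCatalan⇒good : {μ : Vec ℕ k} (T : Filling μ) → IsCondensedCatalan T → good T ≡ true
isCondensedCatalan⇒good []        _ = refl
isCondensedCatalan⇒good (row ∷ T) (leftβ , aboveα , free) = ∧-intro
  (isCondensedCatalan⇒good T
    ( leftβ ∘ suc
    , (λ r c eq r′ c′ lt → aboveα (suc r) c eq (suc r′) c′ (s≤s lt))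
    , λ r c nα → free (suc r) c λ { (suc r′) c′ (s≤s lt) → nα r′ c′ lt }))
  (isRow⇒fitsRow (alive T) row (record
    { emptyLeftOfβ = leftβ zero
    ; emptyAboveα  = λ c ne → alive-complete T (toℕ c) λ r c′ eq isα →
        ne (aboveα (suc r) c′ isα zero c (s≤s z≤n) (≡.sym eq))
    ; filled       = λ c l nβ → nonblank (free zero c
        (λ { (suc r) c′ _ eq → alive-sound T (toℕ c) l r c′ eq }) nβ)
    }))
  where
  nonblank : ∀ {e} → e ≡ αᵉ ⊎ e ≡ βᵉ → e ≢ blank
  nonblank (inj₁ refl) = α≢blank
  nonblank (inj₂ refl) = β≢blank

countTrue-all : ∀ (live : ℕ → Bool) d → (∀ c → live c ≡ true) → countTrue live d ≡ d
countTrue-all live zero    f = refl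
countTrue-all live (suc d) f rewrite f 0 = ≡.cong suc (countTrue-all (live ∘ suc) d (f ∘ suc))

countTrue-+ : ∀ (live : ℕ → Bool) y d → (∀ c → y ≤ c → live c ≡ true) →
  countTrue live (y ℕ.+ d) ≡ countTrue live y ℕ.+ d
countTrue-+ live zero    d f = countTrue-all live d λ c → f c z≤n
countTrue-+ live (suc y) d f with live 0
... | true  = ≡.cong suc (countTrue-+ (live ∘ suc) y d λ c p → f (suc c) (s≤s p))
... | false = countTrue-+ (live ∘ suc) y d λ c p → f (suc c) (s≤s p)

nC0≡1 : ∀ n → n C 0 ≡ 1
nC0≡1 n = ≡.trans (nCk≡nC[n∸k] {0} {n} z≤n) (nCn≡1 n)

module _ {c ℓ : Level} (R : CommutativeRing c ℓ) where

  open CommutativeRing R hiding (refl; sym; trans; zero)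
  open CommutativeRing R using () renaming (refl to ≈-refl; sym to ≈-sym; trans to ≈-trans)
  open Over R
  open NaturalCoefficients commutativeSemiring using (solve; con; _:+_; _:*_; _:=_)
  open SemiringExp semiring using (^-homo-*)
  open SemiringSum semiring using (*-distribˡ-sum)
  open CommutativeSemiringExp commutativeSemiring using (^-distrib-*)
  open SemiringMult semiring using (×-homo-+)
  open MonoidSum +-monoid using (sum; sum-cong-≋)
  open import Relation.Binary.Reasoning.Setoid setoid

  -- Sums over lists

  module _ {x : Level} {X : Set x} where

    ∑ : List X → (X → Carrier) → Carrier
    ∑ xs F = List.foldr _+_ 0# (List.map F xs)

    ∑-cong : ∀ {F G : X → Carrier} (xs : List X) → (∀ x → F x ≈ G x) → ∑ xs F ≈ ∑ xs G
    ∑-cong []       eq = ≈-refl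
    ∑-cong (x ∷ xs) eq = +-cong (eq x) (∑-cong xs eq)

    ∑-++ : ∀ (F : X → Carrier) xs ys → ∑ (xs ++ ys) F ≈ ∑ xs F + ∑ ys F
    ∑-++ F []       ys = ≈-sym (+-identityˡ _)
    ∑-++ F (x ∷ xs) ys = ≈-trans (+-congˡ (∑-++ F xs ys)) (≈-sym (+-assoc _ _ _))

    ∑-0 : (xs : List X) → ∑ xs (λ _ → 0#) ≈ 0#
    ∑-0 []       = ≈-refl
    ∑-0 (x ∷ xs) = ≈-trans (+-identityˡ _) (∑-0 xs)

    ∑-+ : ∀ (F G : X → Carrier) xs → ∑ xs (λ x → F x + G x) ≈ ∑ xs F + ∑ xs G
    ∑-+ F G []       = ≈-sym (+-identityˡ _)
    ∑-+ F G (x ∷ xs) = ≈-trans (+-congˡ (∑-+ F G xs))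
      (solve 4 (λ a b c d → (a :+ b) :+ (c :+ d) := (a :+ c) :+ (b :+ d)) ≈-refl _ _ _ _)

    ∑-*ˡ : ∀ a (F : X → Carrier) xs → ∑ xs (λ x → a * F x) ≈ a * ∑ xs F
    ∑-*ˡ a F []       = ≈-sym (zeroʳ a)
    ∑-*ˡ a F (x ∷ xs) = ≈-trans (+-congˡ (∑-*ˡ a F xs)) (≈-sym (distribˡ a _ _))

    ∑-filter : ∀ {p} {P : Pred X p} (P? : Decidable P) (b : X → Bool) →
      (∀ x → P x → b x ≡ true) → (∀ x → b x ≡ true → P x) →
      ∀ (F : X → Carrier) xs → ∑ (filter P? xs) F ≈ ∑ xs (λ x → if b x then F x else 0#)
    ∑-filter P? b f g F []       = ≈-refl
    ∑-filter P? b f g F (x ∷ xs) with P? x | b x in eq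
    ... | yes p | true  = +-congˡ (∑-filter P? b f g F xs)
    ... | yes p | false with () ← ≡.trans (≡.sym eq) (f x p)
    ... | no ¬p | true  = ⊥-elim (¬p (g x eq))
    ... | no ¬p | false = ≈-trans (∑-filter P? b f g F xs) (≈-sym (+-identityˡ _))

  ∑-map : ∀ {x y} {X : Set x} {Y : Set y} (f : X → Y) (F : Y → Carrier) xs →
    ∑ (List.map f xs) F ≈ ∑ xs (F ∘ f)
  ∑-map f F []       = ≈-refl
  ∑-map f F (x ∷ xs) = +-congˡ (∑-map f F xs)

  ∑-cartesianProductWith : ∀ {x y z} {X : Set x} {Y : Set y} {Z : Set z}
    (f : X → Y → Z) (F : Z → Carrier) xs ys →
    ∑ (cartesianProductWith f xs ys) F ≈ ∑ ys (λ y → ∑ xs (λ x → F (f x y)))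
  ∑-cartesianProductWith f F []       ys = ≈-sym (∑-0 ys)
  ∑-cartesianProductWith f F (x ∷ xs) ys = begin
    ∑ (List.map (f x) ys ++ cartesianProductWith f xs ys) F
      ≈⟨ ∑-++ F (List.map (f x) ys) _ ⟩
    ∑ (List.map (f x) ys) F + ∑ (cartesianProductWith f xs ys) F
      ≈⟨ +-cong (∑-map (f x) F ys) (∑-cartesianProductWith f F xs ys) ⟩
    ∑ ys (λ y → F (f x y)) + ∑ ys (λ y → ∑ xs (λ x → F (f x y)))
      ≈⟨ ∑-+ _ _ ys ⟨
    ∑ ys (λ y → F (f x y) + ∑ xs (λ x → F (f x y))) ∎

  -- The generating function by rows

  module _ (α β : Carrier) where

    -- stack p m is the generating function of p rows with m live columns below them.
    stack : ℕ → ℕ → Carrier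
    stack zero    m       = 1#
    stack (suc p) zero    = 1#
    stack (suc p) (suc m) = β * stack p (suc m) + α * stack (suc p) m

    -- The recursion of `stack` with boundary values `f p` at `d = 0`. In its use `d` counts the
    -- columns to the right of all rows below, which are certain to be live.
    extend : (ℕ → Carrier) → ℕ → ℕ → Carrier
    extend f p       zero    = f p
    extend f zero    (suc d) = extend f zero d
    extend f (suc p) (suc d) = β * extend f p (suc d) + α * extend f (suc p) d

    -- onTop μ m p is the generating function, without the factor αᵏβⁿ⁻ᵏ, of the
    -- partition μ with p parts m ≥ μ₁ put in front.
    onTop : Vec ℕ k → ℕ → ℕ → Carrier
    onTop []      m p = extend (λ _ → 1#) p m
    onTop (y ∷ μ) m p = extend (λ q → onTop μ y (suc q)) p (m ∸ y)

    Z : Vec ℕ k → Carrier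
    Z []      = 1#
    Z (x ∷ μ) = onTop μ x 1

    -- withβ f a sums over the fillings of a row with a live columns that contain a β,
    -- f being applied to the number of columns that stay live.
    withβ : (ℕ → Carrier) → ℕ → Carrier
    withβ f zero    = 0#
    withβ f (suc a) = withβ (f ∘ suc) a + β * α ^ a * f 1

    -- The definition of `withβ` looks at the leftmost live column, this recursion at the rightmost:
    -- it holds the β and all columns stay live, or it holds an α and is lost.
    withβ-suc : ∀ f a → withβ f (suc a) ≈ β * f (suc a) + α * withβ f a
    withβ-suc f zero    =
      solve 3 (λ a b x → con 0 :+ b :* con 1 :* x := b :* x :+ a :* con 0) ≈-refl α β (f 1)
    withβ-suc f (suc a) = begin
      withβ (f ∘ suc) (suc a) + β * (α * α ^ a) * f 1
        ≈⟨ +-congʳ (withβ-suc (f ∘ suc) a) ⟩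
      β * f (suc (suc a)) + α * withβ (f ∘ suc) a + β * (α * α ^ a) * f 1
        ≈⟨ solve 6 (λ a b x y z w → b :* x :+ a :* y :+ b :* (a :* z) :* w
                     := b :* x :+ a :* (y :+ b :* z :* w)) ≈-refl α β _ _ _ _ ⟩
      β * f (suc (suc a)) + α * withβ f (suc a) ∎

    -- The left side removes the whole bottom row of `suc p` rows: it contains a β, or α fills its
    -- live columns and none stays live. The definition of `stack` removes a single box; `withβ-suc`
    -- reconciles the two.
    stack-suc : ∀ p a → withβ (stack p) a + α ^ a * stack p 0 ≈ stack (suc p) a
    stack-suc zero    zero    = solve 0 (con 0 :+ con 1 :* con 1 := con 1) ≈-refl
    stack-suc (suc p) zero    = solve 0 (con 0 :+ con 1 :* con 1 := con 1) ≈-refl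
    stack-suc p       (suc a) = begin
      withβ (stack p) (suc a) + α * α ^ a * stack p 0
        ≈⟨ +-congʳ (withβ-suc (stack p) a) ⟩
      β * stack p (suc a) + α * withβ (stack p) a + α * α ^ a * stack p 0
        ≈⟨ solve 5 (λ u a x y z → u :+ a :* x :+ a :* y :* z := u :+ a :* (x :+ y :* z))
             ≈-refl _ _ _ _ _ ⟩
      β * stack p (suc a) + α * (withβ (stack p) a + α ^ a * stack p 0)
        ≈⟨ +-congˡ (*-congˡ (stack-suc p a)) ⟩
      β * stack p (suc a) + α * stack (suc p) a ∎

    -- Sums over the fillings of one row

    rowWeight : Vec Entry m → Carrier
    rowWeight row = α ^ Vec.count (αᵉ ≟ᵉ_) row * β ^ Vec.count (βᵉ ≟ᵉ_) row

    fillingWeight : {μ : Vec ℕ k} → Filling μ → Carrier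
    fillingWeight T = α ^ count αᵉ T * β ^ count βᵉ T

    fillingWeight-∷ : {μ : Vec ℕ k} (row : Vec Entry m) (T : Filling μ) →
      fillingWeight {μ = m ∷ μ} (row ∷ T) ≈ fillingWeight T * rowWeight row
    fillingWeight-∷ row T = ≈-trans
      (*-cong (^-homo-* α (Vec.count (αᵉ ≟ᵉ_) row) _) (^-homo-* β (Vec.count (βᵉ ≟ᵉ_) row) _))
      (solve 4 (λ a b c d → a :* b :* (c :* d) := b :* d :* (a :* c)) ≈-refl _ _ _ _)

    liveAfter : (ℕ → Bool) → Vec Entry m → ℕ → Bool
    liveAfter live row c = live c ∧ notα row c

    -- The effect of a new leftmost box on a summand `G b n`, where `b` tells whether the row has a
    -- β and `n` counts the columns that stay live. In a live column the box is blank if a β lies to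
    -- its right and holds α or β if not; only α makes the column dead.
    prepend : (isLive : Bool) → (Bool → ℕ → Carrier) → Bool → ℕ → Carrier
    prepend true  G true  n = G true (suc n)
    prepend true  G false n = α * G false n + β * G true (suc n)
    prepend false G b     n = G b n

    ∑-first : ∀ live (G : Bool → ℕ → Carrier) (row : Vec Entry m) →
      ∑ entries (λ e → if fitsRow live (e ∷ row)
        then rowWeight (e ∷ row) * G (hasβ (e ∷ row)) (countTrue (liveAfter live (e ∷ row)) (suc m))
        else 0#)
      ≈ (if fitsRow (live ∘ suc) row
         then rowWeight row *
              prepend (live 0) G (hasβ row) (countTrue (liveAfter (live ∘ suc) row) m)
         else 0#)
    ∑-first live G row with fitsRow (live ∘ suc) row | hasβ row | live 0
    ... | true  | true  | true  = solve 1 (λ x → x :+ (con 0 :+ (con 0 :+ con 0)) := x) ≈-refl _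
    ... | true  | true  | false = solve 1 (λ x → x :+ (con 0 :+ (con 0 :+ con 0)) := x) ≈-refl _
    ... | true  | false | false = solve 1 (λ x → x :+ (con 0 :+ (con 0 :+ con 0)) := x) ≈-refl _
    ... | true  | false | true  =
      solve 6 (λ a b x y u v → con 0 :+ (a :* x :* y :* u :+ (x :* (b :* y) :* v :+ con 0))
                := x :* y :* (a :* u :+ b :* v)) ≈-refl α β _ _ _ _
    ... | false | true  | true  = solve 0 (con 0 :+ (con 0 :+ (con 0 :+ con 0)) := con 0) ≈-refl
    ... | false | true  | false = solve 0 (con 0 :+ (con 0 :+ (con 0 :+ con 0)) := con 0) ≈-refl
    ... | false | false | true  = solve 0 (con 0 :+ (con 0 :+ (con 0 :+ con 0)) := con 0) ≈-refl
    ... | false | false | false = solve 0 (con 0 :+ (con 0 :+ (con 0 :+ con 0)) := con 0) ≈-refl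

    withβ-prepend : ∀ isLive (G : Bool → ℕ → Carrier) n →
      let n′ = (if isLive then suc else λ n → n) n in
      withβ (prepend isLive G true) n + α ^ n * prepend isLive G false 0
        ≈ withβ (G true) n′ + α ^ n′ * G false 0
    withβ-prepend false G n = ≈-refl
    withβ-prepend true  G n =
      solve 6 (λ a b x y u v → x :+ y :* (a :* u :+ b :* v) := x :+ b :* y :* v :+ a :* y :* u)
        ≈-refl α β _ _ _ _

    -- `G` may depend on `hasβ row` because the induction adds boxes on the left, where a β to the
    -- right matters. A row without β has α in every live column, whence the last term.
    ∑-rows : ∀ m live (G : Bool → ℕ → Carrier) →
      ∑ (rows m) (λ row → if fitsRow live row
        then rowWeight row * G (hasβ row) (countTrue (liveAfter live row) m) else 0#)
      ≈ withβ (G true) (countTrue live m) + α ^ countTrue live m * G false 0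
    ∑-rows zero live G =
      solve 1 (λ x → con 1 :* con 1 :* x :+ con 0 := con 0 :+ con 1 :* x) ≈-refl (G false 0)
    ∑-rows (suc m) live G = begin
      ∑ (rows (suc m)) _
        ≈⟨ ∑-cartesianProductWith _∷_ _ entries (rows m) ⟩
      _ ≈⟨ ∑-cong (rows m) (∑-first live G) ⟩
      _ ≈⟨ ∑-rows m (live ∘ suc) (prepend (live 0) G) ⟩
      _ ≈⟨ withβ-prepend (live 0) G (countTrue (live ∘ suc) m) ⟩
      _ ∎

    -- The generating function of `μ` with `p` more rows above it that meet `live T` live columns.
    total : (μ : Vec ℕ k) → (Filling μ → ℕ) → ℕ → Carrier
    total μ live p =
      ∑ (fillings μ) (λ T → if good T then fillingWeight T * stack p (live T) else 0#)

    total-cong : ∀ (μ : Vec ℕ k) {live live′ : Filling μ → ℕ} p →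
      (∀ T → live T ≡ live′ T) → total μ live p ≈ total μ live′ p
    total-cong μ p eq = ∑-cong (fillings μ) λ T →
      reflexive (≡.cong (λ a → if good T then fillingWeight T * stack p a else 0#) (eq T))

    total-suc : ∀ (μ : Vec ℕ k) (live : Filling μ → ℕ) p →
      total μ (suc ∘ live) (suc p) ≈ β * total μ (suc ∘ live) p + α * total μ live (suc p)
    total-suc μ live p = begin
      total μ (suc ∘ live) (suc p)
        ≈⟨ ∑-cong (fillings μ) (λ T → linear (good T) (fillingWeight T) _ _) ⟩
      _ ≈⟨ ∑-+ _ _ (fillings μ) ⟩
      _ ≈⟨ +-cong (∑-*ˡ β _ (fillings μ)) (∑-*ˡ α _ (fillings μ)) ⟩
      β * total μ (suc ∘ live) p + α * total μ live (suc p) ∎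
      where
      linear : ∀ b w s t → (if b then w * (β * s + α * t) else 0#)
        ≈ β * (if b then w * s else 0#) + α * (if b then w * t else 0#)
      linear true  w s t =
        solve 5 (λ a b w s t → w :* (b :* s :+ a :* t) := b :* (w :* s) :+ a :* (w :* t))
          ≈-refl α β w s t
      linear false w s t = solve 2 (λ a b → con 0 := b :* con 0 :+ a :* con 0) ≈-refl α β

    -- The `p` rows on top meet the same `y` columns as the first row of the partition, so this row
    -- joins them: `∑-rows` sums over its fillings, and `stack-suc` makes `suc p` rows out of `p`.
    total-∷ : ∀ y (ν : Vec ℕ k) p →
      total (y ∷ ν) (λ T → countTrue (alive T) y) p ≈ total ν (λ T → countTrue (alive T) y) (suc p)
    total-∷ y ν p = begin
      total (y ∷ ν) (λ T → countTrue (alive T) y) p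
        ≈⟨ ∑-cartesianProductWith _∷_ _ (rows y) (fillings ν) ⟩
      _ ≈⟨ ∑-cong (fillings ν) (λ T → overRows T (good T) refl) ⟩
      total ν (λ T → countTrue (alive T) y) (suc p) ∎
      where
      overRows : (T : Filling ν) → ∀ b → good T ≡ b →
        ∑ (rows y) (λ row → if b ∧ fitsRow (alive T) row
          then fillingWeight {μ = y ∷ ν} (row ∷ T) * stack p (countTrue (liveAfter (alive T) row) y)
          else 0#)
        ≈ (if b then fillingWeight T * stack (suc p) (countTrue (alive T) y) else 0#)
      overRows T false _ = ∑-0 (rows y)
      overRows T true  _ = begin
        _ ≈⟨ ∑-cong (rows y) factor ⟩
        _ ≈⟨ ∑-*ˡ (fillingWeight T) _ (rows y) ⟩
        _ ≈⟨ *-congˡ (∑-rows y (alive T) (λ _ → stack p)) ⟩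
        _ ≈⟨ *-congˡ (stack-suc p (countTrue (alive T) y)) ⟩
        _ ∎
        where
        factor : ∀ row → (if fitsRow (alive T) row
          then fillingWeight {μ = y ∷ ν} (row ∷ T) * stack p (countTrue (liveAfter (alive T) row) y)
          else 0#)
          ≈ fillingWeight T * (if fitsRow (alive T) row
          then rowWeight row * stack p (countTrue (liveAfter (alive T) row) y)
          else 0#)
        factor row with fitsRow (alive T) row
        ... | true  = ≈-trans (*-congʳ (fillingWeight-∷ row T)) (*-assoc _ _ _)
        ... | false = ≈-sym (zeroʳ _)

    stack≈extend : ∀ p m → stack p m ≈ extend (λ _ → 1#) p m
    stack≈extend zero    zero    = ≈-refl
    stack≈extend (suc p) zero    = ≈-refl
    stack≈extend zero    (suc m) = stack≈extend zero m
    stack≈extend (suc p) (suc m) =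
      +-cong (*-congˡ (stack≈extend p (suc m))) (*-congˡ (stack≈extend (suc p) m))

    total≈onTop : ∀ {μ : Vec ℕ k} → Linked _≥_ μ → ∀ m → part μ 0 ≤ m → ∀ p →
      total μ (λ T → countTrue (alive T) m) p ≈ onTop μ m p
    total≈onTop {μ = []} _ m _ p = begin
      1# * 1# * stack p (countTrue (λ _ → true) m) + 0#
        ≈⟨ solve 1 (λ x → con 1 :* con 1 :* x :+ con 0 := x) ≈-refl _ ⟩
      stack p (countTrue (λ _ → true) m)
        ≡⟨ ≡.cong (stack p) (countTrue-all _ m λ _ → refl) ⟩
      stack p m
        ≈⟨ stack≈extend p m ⟩
      extend (λ _ → 1#) p m ∎
    total≈onTop {μ = y ∷ ν} ls m y≤m p = begin
      total (y ∷ ν) (λ T → countTrue (alive T) m) p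
        ≈⟨ total-cong (y ∷ ν) p split ⟩
      total (y ∷ ν) (λ T → (m ∸ y) ℕ.+ countTrue (alive T) y) p
        ≈⟨ beyond (m ∸ y) p ⟩
      onTop (y ∷ ν) m p ∎
      where
      split : (T : Filling (y ∷ ν)) → countTrue (alive T) m ≡ (m ∸ y) ℕ.+ countTrue (alive T) y
      split T = ≡.trans (≡.cong (countTrue (alive T)) (≡.sym (ℕ.m+[n∸m]≡n y≤m)))
        (≡.trans (countTrue-+ (alive T) y (m ∸ y) (alive-beyond ls T)) (ℕ.+-comm _ (m ∸ y)))

      -- At `d = 0` the first part joins the rows on top. Every further column lies to the right of
      -- all of `y ∷ ν`, hence is live for each filling and obeys the recursion of `stack`.
      beyond : ∀ d p → total (y ∷ ν) (λ T → d ℕ.+ countTrue (alive T) y) p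
        ≈ extend (λ q → onTop ν y (suc q)) p d
      beyond zero    p       = ≈-trans (total-∷ y ν p)
        (total≈onTop (Linked.tail ls) y (head-≥ ls) (suc p))
      beyond (suc d) zero    = beyond d zero
      beyond (suc d) (suc p) = ≈-trans
        (total-suc (y ∷ ν) (λ T → d ℕ.+ countTrue (alive T) y) p)
        (+-cong (*-congˡ (beyond (suc d) p)) (*-congˡ (beyond d (suc p))))

    extend-0 : ∀ f d → extend f 0 d ≈ f 0
    extend-0 f zero    = ≈-refl
    extend-0 f (suc d) = extend-0 f d

    onTop-0 : ∀ (μ : Vec ℕ k) m → onTop μ m 0 ≈ Z μ
    onTop-0 []      m = extend-0 (λ _ → 1#) m
    onTop-0 (y ∷ μ) m = extend-0 _ (m ∸ y)

    -- Once the common factor is taken out, the sum is a `total` with `p = 0`, since `stack 0` is 1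
    -- for any number of live columns.
    P≈Z : ∀ n {μ : Vec ℕ k} → Linked _≥_ μ → P n μ α β ≈ α ^ k * β ^ (n ∸ k) * Z μ
    P≈Z {k = k} n {μ} ls = begin
      P n μ α β
        ≈⟨ ∑-filter isCondensedCatalan? good isCondensedCatalan⇒good good⇒isCondensedCatalan
             (weight n α β) (fillings μ) ⟩
      ∑ (fillings μ) (λ T → if good T then weight n α β T else 0#)
        ≈⟨ ∑-cong (fillings μ) factor ⟩
      _ ≈⟨ ∑-*ˡ (α ^ k * β ^ (n ∸ k)) _ (fillings μ) ⟩
      α ^ k * β ^ (n ∸ k) * total μ (λ T → countTrue (alive T) (part μ 0)) 0
        ≈⟨ *-congˡ (total≈onTop ls (part μ 0) ℕ.≤-refl 0) ⟩
      α ^ k * β ^ (n ∸ k) * onTop μ (part μ 0) 0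
        ≈⟨ *-congˡ (onTop-0 μ (part μ 0)) ⟩
      α ^ k * β ^ (n ∸ k) * Z μ ∎
      where
      factor : (T : Filling μ) → (if good T then weight n α β T else 0#)
        ≈ α ^ k * β ^ (n ∸ k) * (if good T then fillingWeight T * 1# else 0#)
      factor T with good T
      ... | true  = ≈-trans (*-cong (^-homo-* α k _) (^-homo-* β (n ∸ k) _))
        (solve 4 (λ a b c d → a :* b :* (c :* d) := a :* c :* (b :* d :* con 1)) ≈-refl _ _ _ _)
      ... | false = ≈-sym (zeroʳ _)

  -- Hessenberg determinants

  det-cong : (M N : Matrix k) → (∀ i j → M i j ≈ N i j) → det M ≈ det N
  det-cong {zero}  M N eq = ≈-refl
  det-cong {suc k} M N eq = sum-cong-≋ λ i →
    *-cong (*-congˡ {(- 1#) ^ toℕ i} (eq i zero)) (det-cong _ _ λ r s → eq (punchIn i r) (suc s))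

  sum-0 : ∀ {n} (f : Fin n → Carrier) → (∀ i → f i ≈ 0#) → sum f ≈ 0#
  sum-0 {zero}  f eq = ≈-refl
  sum-0 {suc n} f eq = ≈-trans (+-cong (eq zero) (sum-0 (f ∘ suc) (eq ∘ suc))) (+-identityˡ 0#)

  below : Fin k → Carrier
  below zero    = 1#
  below (suc _) = 0#

  border : (Fin (suc k) → Carrier) → Matrix k → Matrix (suc k)
  border v M zero    j       = v j
  border v M (suc i) zero    = below i
  border v M (suc i) (suc j) = M i j

  deleteRow₁ : (Fin (suc (suc k)) → Carrier) → Matrix (suc k) → Matrix (suc k)
  deleteRow₁ v M zero    j = v (suc j)
  deleteRow₁ v M (suc i) j = M (suc i) j

  -- The first column is `v zero`, 1, 0, ..., 0, so only two cofactors survive. The second minor is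
  -- `M` with its first row replaced by the rest of `v`.
  det-border : (v : Fin (suc (suc k)) → Carrier) (M : Matrix (suc k)) →
    det (border v M) ≈ v zero * det M + - 1# * det (deleteRow₁ v M)
  det-border v M = begin
    det (border v M)
      ≈⟨ +-congˡ (+-cong (*-congˡ (det-cong (minor (suc zero)) (deleteRow₁ v M)
           λ { zero _ → ≈-refl ; (suc _) _ → ≈-refl }))
           (sum-0 (λ i → (- 1#) ^ toℕ (suc (suc i)) * 0# * det (minor (suc (suc i))))
             λ i → ≈-trans (*-congʳ (zeroʳ _)) (zeroˡ _))) ⟩
    1# * v zero * det M + (- 1# * 1# * 1# * det (deleteRow₁ v M) + 0#)
      ≈⟨ solve 4 (λ x d e d′ → con 1 :* x :* d :+ (e :* con 1 :* con 1 :* d′ :+ con 0)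
           := x :* d :+ e :* d′) ≈-refl _ _ _ _ ⟩
    v zero * det M + - 1# * det (deleteRow₁ v M) ∎
    where
    minor : Fin (suc (suc _)) → Matrix (suc _)
    minor i r s = border v M (punchIn i r) (suc s)

  -- Expansion of det (border v M), M being Hessenberg with subdiagonal 1 and D giving
  -- its trailing principal minors.
  expand : (∀ {k} → Vec ℕ k → Carrier) → Vec ℕ k → (Fin (suc k) → Carrier) → Carrier
  expand D []      v = v zero
  expand D (y ∷ ν) v = v zero * D (y ∷ ν) + - 1# * expand D ν (v ∘ suc)

  expand-cong : ∀ (D : ∀ {k} → Vec ℕ k → Carrier) (μ : Vec ℕ k) {v w} →
    (∀ j → v j ≈ w j) → expand D μ v ≈ expand D μ w
  expand-cong D []      eq = eq zero
  expand-cong D (y ∷ μ) eq =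
    +-cong (*-congʳ (eq zero)) (*-congˡ (expand-cong D μ (eq ∘ suc)))

  expand-linear : ∀ (D : ∀ {k} → Vec ℕ k → Carrier) (μ : Vec ℕ k) a v w →
    expand D μ (λ j → a * (v j + w j)) ≈ a * (expand D μ v + expand D μ w)
  expand-linear D []      a v w = ≈-refl
  expand-linear D (y ∷ μ) a v w = ≈-trans
    (+-congˡ (*-congˡ (expand-linear D μ a (v ∘ suc) (w ∘ suc))))
    (solve 7 (λ a x y d e p q → a :* (x :+ y) :* d :+ e :* (a :* (p :+ q))
        := a :* (x :* d :+ e :* p :+ (y :* d :+ e :* q))) ≈-refl a _ _ _ _ _ _)

  -- The matrix A as a Hessenberg matrix

  module _ {α β : Carrier} (α-unit : Unit α) (β-unit : Unit β) where

    α⁻¹ : Carrier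
    α⁻¹ = proj₁ α-unit

    detA : ∀ {k} → Vec ℕ k → Carrier
    detA μ = det (A μ α-unit β-unit)

    -- Below the diagonal all lower indices of binomials are negative, except in the term
    -- `β * bin _ 0` just below it. There λᵢ is λⱼ₊₁, so that α disappears, and this β cancels the
    -- power β⁻¹.
    A-subdiagonal : ∀ y (ν : Vec ℕ k) i → A (y ∷ ν) α-unit β-unit (suc i) zero ≈ below i
    A-subdiagonal y (z ∷ ν) zero rewrite ℤ.n⊖n≡0 z = begin
      _ ≈⟨ +-congˡ (*-congˡ (sum-0 {y ∸ z} _ λ l →
             solve 2 (λ x b → x :* (con 0 :+ b :* con 0) := con 0) ≈-refl (α ^ toℕ l) β)) ⟩
      _ ≈⟨ solve 3 (λ b b⁻¹ c → b⁻¹ :* con 1 :* con 1 :* (con 0 :+ b :* (con 1 :+ con 0)) :+ c :* con 0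
             := b⁻¹ :* b) ≈-refl β (proj₁ β-unit) _ ⟩
      proj₁ β-unit * β
        ≈⟨ proj₁ (proj₂ β-unit) ⟩
      1# ∎
    A-subdiagonal y (z ∷ ν) (suc i) = ≈-trans
      (+-congˡ (*-congˡ (sum-0 {y ∸ z} _ λ l →
         solve 2 (λ x b → x :* (con 0 :+ b :* con 0) := con 0) ≈-refl (α ^ toℕ l) β)))
      (solve 3 (λ u v b → u :* (con 0 :+ b :* con 0) :+ v :* con 0 := con 0) ≈-refl _ _ β)

    A-shift : ∀ y (ν : Vec ℕ k) i j → A (y ∷ ν) α-unit β-unit (suc i) (suc j) ≈ A ν α-unit β-unit i j
    A-shift y ν i j rewrite ℤ.[1+m]⊖[1+n]≡m⊖n (toℕ j) (toℕ i) = ≈-refl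

    -- `A (x ∷ μ)` is `A μ` bordered by its first row, and `A μ` is again of this form, so that
    -- `det-border` can be iterated.
    det-A : ∀ x (μ : Vec ℕ k) → detA (x ∷ μ) ≈ expand detA μ (A (x ∷ μ) α-unit β-unit zero)
    det-A x μ = ≈-trans (det-cong (A (x ∷ μ) α-unit β-unit)
        (border (A (x ∷ μ) α-unit β-unit zero) (A μ α-unit β-unit)) λ where
        zero    j       → ≈-refl
        (suc i) zero    → A-subdiagonal x μ i
        (suc i) (suc j) → A-shift x μ i j)
      (det-expand μ _)
      where
      det-expand : ∀ (μ : Vec ℕ k) v → det (border v (A μ α-unit β-unit)) ≈ expand detA μ v
      det-expand []      v = solve 1 (λ x → con 1 :* x :* con 1 :+ con 0 := x) ≈-refl (v zero)
      det-expand (y ∷ ν) v = ≈-trans (det-border v _) (+-congˡ (*-congˡ (≈-trans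
        (det-cong (deleteRow₁ v (A (y ∷ ν) α-unit β-unit)) (border (v ∘ suc) (A ν α-unit β-unit)) λ where
          zero    j       → ≈-refl
          (suc i) zero    → A-subdiagonal y ν i
          (suc i) (suc j) → A-shift y ν i j)
        (det-expand ν (v ∘ suc)))))


    -- Taylor expansion of the antiderivative

    onTop-suc : ∀ (μ : Vec ℕ k) u p → part μ 0 ≤ u →
      onTop α β μ (suc u) (suc p) ≈ β * onTop α β μ (suc u) p + α * onTop α β μ u (suc p)
    onTop-suc []      u p y≤u = ≈-refl
    onTop-suc (y ∷ μ) u p y≤u rewrite ℕ.+-∸-assoc 1 y≤u = ≈-refl

    onTop-head : ∀ y (ν : Vec ℕ k) p → onTop α β (y ∷ ν) y p ≡ onTop α β ν y (suc p)
    onTop-head y ν p rewrite ℕ.n∸n≡0 y = refl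

    cancel : ∀ x → x + - 1# * x ≈ 0#
    cancel x = ≈-trans (solve 2 (λ x e → x :+ e :* x := (con 1 :+ e) :* x) ≈-refl x (- 1#))
      (≈-trans (*-congʳ (-‿inverseʳ 1#)) (zeroˡ x))

    -- The coefficient of degree `t` in the product of the power series with coefficients `c` and
    -- `f`.
    conv : ℕ → (ℕ → Carrier) → (ℕ → Carrier) → Carrier
    conv zero    c f = c 0 * f 0
    conv (suc t) c f = c 0 * f (suc t) + conv t (c ∘ suc) f

    conv-cong : ∀ t {c c′ f f′} → (∀ i → c i ≈ c′ i) → (∀ i → f i ≈ f′ i) →
      conv t c f ≈ conv t c′ f′
    conv-cong zero    p q = *-cong (p 0) (q 0)
    conv-cong (suc t) p q = +-cong (*-cong (p 0) (q (suc t))) (conv-cong t (p ∘ suc) q)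

    conv-last : ∀ t c f → conv (suc t) c f ≈ conv t c (f ∘ suc) + c (suc t) * f 0
    conv-last zero    c f = ≈-refl
    conv-last (suc t) c f = ≈-trans (+-congˡ (conv-last t (c ∘ suc) f)) (≈-sym (+-assoc _ _ _))

    conv-*ˡ : ∀ t a c f → conv t c (λ i → a * f i) ≈ a * conv t c f
    conv-*ˡ zero    a c f = solve 3 (λ a c f → c :* (a :* f) := a :* (c :* f)) ≈-refl a _ _
    conv-*ˡ (suc t) a c f = ≈-trans (+-congˡ (conv-*ˡ t a (c ∘ suc) f))
      (solve 4 (λ a c f r → c :* (a :* f) :+ a :* r := a :* (c :* f :+ r)) ≈-refl a _ _ _)

    -- Summation by parts: the factor 1 + γx moves from one power series to the other, at the cost
    -- of two boundary terms.
    conv-by-parts : ∀ t γ b (f : ℕ → Carrier) →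
      conv t (λ i → b (suc i) + γ * b i) (f ∘ suc) + γ * b (suc t) * f 0
        ≈ γ * b 0 * f (suc t) + conv t (b ∘ suc) (λ i → f (suc i) + γ * f i)
    conv-by-parts zero    γ b f =
      solve 5 (λ g b b′ f f′ → (b′ :+ g :* b) :* f′ :+ g :* b′ :* f
                 := g :* b :* f′ :+ b′ :* (f′ :+ g :* f)) ≈-refl γ _ _ _ _
    conv-by-parts (suc t) γ b f = begin
      (b 1 + γ * b 0) * f (suc (suc t)) + conv t (λ i → b (suc (suc i)) + γ * b (suc i)) (f ∘ suc)
        + γ * b (suc (suc t)) * f 0
        ≈⟨ +-assoc _ _ _ ⟩
      (b 1 + γ * b 0) * f (suc (suc t)) + (conv t (λ i → b (suc (suc i)) + γ * b (suc i)) (f ∘ suc)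
        + γ * b (suc (suc t)) * f 0)
        ≈⟨ +-congˡ (conv-by-parts t γ (b ∘ suc) f) ⟩
      _ ≈⟨ solve 6 (λ g b b′ f f′ r → (b′ :+ g :* b) :* f′ :+ (g :* b′ :* f :+ r)
             := g :* b :* f′ :+ (b′ :* (f′ :+ g :* f) :+ r)) ≈-refl γ _ _ _ _ _ ⟩
      γ * b 0 * f (suc (suc t)) + conv (suc t) (b ∘ suc) (λ i → f (suc i) + γ * f i) ∎

    -β : Carrier
    -β = - 1# * β

    -- The coefficient of x^q in (1 - βx)^u.
    coef : ℕ → ℕ → Carrier
    coef u q = -β ^ q * bin u (ℤ.+ q)

    bin-0 : ∀ u → bin u (ℤ.+ 0) ≈ 1#
    bin-0 u rewrite nC0≡1 u = +-identityʳ 1#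

    bin-Pascal : ∀ u q → bin (suc u) (ℤ.+ suc q) ≈ bin u (ℤ.+ q) + bin u (ℤ.+ suc q)
    bin-Pascal u q rewrite ≡.sym (nCk+nC[k+1]≡[n+1]C[k+1] u q) = ×-homo-+ 1# (u C q) (u C suc q)

    previous : (ℕ → Carrier) → ℕ → Carrier
    previous c zero    = 0#
    previous c (suc i) = c i

    coef-suc : ∀ u q → coef (suc u) q ≈ coef u q + -β * previous (coef u) q
    coef-suc u zero    = ≈-trans (*-congˡ (≈-trans (bin-0 (suc u)) (≈-sym (bin-0 u))))
      (solve 2 (λ x g → x := x :+ g :* con 0) ≈-refl _ -β)
    coef-suc u (suc q) = ≈-trans (*-congˡ (bin-Pascal u q))
      (solve 4 (λ g p x y → g :* p :* (x :+ y) := g :* p :* y :+ g :* (p :* x)) ≈-refl -β _ _ _)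

    -- With ∇ the backward difference and s u = α⁻ᵘ onTop μ u (t + 1), this is the sum
    -- expressing s 0 = (1 − ∇)ᵘ s u, cut after t + 1 terms: β⁻¹∇ takes away one of the
    -- rows on top, and there are only t + 1 of them.
    Ψ : Vec ℕ k → ℕ → ℕ → Carrier
    Ψ μ u t = α⁻¹ ^ u * conv t (coef u) (onTop α β μ u ∘ suc)

    -- Raising `u` multiplies the series of `coef u` by 1 - βx. Summation by parts moves this factor
    -- to `onTop`, where the recursion in `u` leaves α times the value at `u`. The cut leaves a
    -- boundary term with no row on top, hence a multiple of `Z`.
    Ψ-suc : ∀ (μ : Vec ℕ k) u t → part μ 0 ≤ u →
      Ψ μ u t ≈ Ψ μ (suc u) t + -β ^ suc t * (α⁻¹ ^ suc u * bin u (ℤ.+ t)) * Z α β μ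
    Ψ-suc μ u t y≤u = ≈-sym (begin
      α⁻¹ * a * conv t (coef (suc u)) (X ∘ suc) + -β * g * (α⁻¹ * a * bin u (ℤ.+ t)) * Z α β μ
        ≈⟨ +-cong (*-congˡ (conv-cong t (coef-suc u) λ _ → ≈-refl)) (*-congˡ (≈-sym (onTop-0 α β μ (suc u)))) ⟩
      α⁻¹ * a * conv t (λ i → coef u i + -β * previous (coef u) i) (X ∘ suc)
        + -β * g * (α⁻¹ * a * bin u (ℤ.+ t)) * X 0
        ≈⟨ solve 6 (λ a′ r b g c x → a′ :* r :+ b :* g :* (a′ :* c) :* x
             := a′ :* (r :+ b :* (g :* c) :* x)) ≈-refl _ _ -β g _ _ ⟩
      α⁻¹ * a * (conv t (λ i → coef u i + -β * previous (coef u) i) (X ∘ suc) + -β * coef u t * X 0)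
        -- The shifted coefficients start with 0, which removes the other boundary term.
        ≈⟨ *-congˡ (conv-by-parts t -β (previous (coef u)) X) ⟩
      α⁻¹ * a * (-β * 0# * X (suc t) + conv t (coef u) (λ i → X (suc i) + -β * X i))
        ≈⟨ *-congˡ (+-congˡ (≈-trans (conv-cong t (λ _ → ≈-refl) lower) (conv-*ˡ t α _ _))) ⟩
      α⁻¹ * a * (-β * 0# * X (suc t) + α * conv t (coef u) (onTop α β μ u ∘ suc))
        ≈⟨ solve 6 (λ i a b x c r → i :* a :* (b :* con 0 :* x :+ c :* r) := i :* c :* (a :* r))
             ≈-refl α⁻¹ a -β _ α _ ⟩
      α⁻¹ * α * Ψ μ u t
        ≈⟨ ≈-trans (*-congʳ (proj₁ (proj₂ α-unit))) (*-identityˡ _) ⟩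
      Ψ μ u t ∎)
      where
      a = α⁻¹ ^ u
      g = -β ^ t
      X = onTop α β μ (suc u)
      lower : ∀ i → X (suc i) + -β * X i ≈ α * onTop α β μ u (suc i)
      lower i = begin
        X (suc i) + -β * X i
          ≈⟨ +-congʳ (onTop-suc μ u i y≤u) ⟩
        β * X i + α * onTop α β μ u (suc i) + - 1# * β * X i
          ≈⟨ solve 4 (λ b x r e → b :* x :+ r :+ e :* b :* x := b :* x :+ e :* (b :* x) :+ r)
               ≈-refl β (X i) _ (- 1#) ⟩
        β * X i + - 1# * (β * X i) + α * onTop α β μ u (suc i)
          ≈⟨ ≈-trans (+-congʳ (cancel (β * X i))) (+-identityˡ _) ⟩
        α * onTop α β μ u (suc i) ∎

    -- A discrete integral over `y ≤ u < d + y`: for `f u` the binomial `bin u t`, its summands are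
    -- what `Ψ-suc` leaves behind, up to a constant.
    ∫ : (ℕ → Carrier) → ℕ → ℕ → Carrier
    ∫ f y zero    = 0#
    ∫ f y (suc d) = α⁻¹ ^ suc (d ℕ.+ y) * f (d ℕ.+ y) + ∫ f y d

    Ψ-+ : ∀ (μ : Vec ℕ k) y t → part μ 0 ≤ y → ∀ d →
      Ψ μ y t ≈ Ψ μ (d ℕ.+ y) t + -β ^ suc t * ∫ (λ u → bin u (ℤ.+ t)) y d * Z α β μ
    Ψ-+ μ y t y≤ zero    = solve 3 (λ x g z → x := x :+ g :* con 0 :* z) ≈-refl _ _ _
    Ψ-+ μ y t y≤ (suc d) = begin
      Ψ μ y t
        ≈⟨ Ψ-+ μ y t y≤ d ⟩
      _ ≈⟨ +-congʳ (Ψ-suc μ (d ℕ.+ y) t (ℕ.≤-trans y≤ (ℕ.m≤n+m y d))) ⟩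
      _ ≈⟨ solve 5 (λ x g s r z → x :+ g :* s :* z :+ g :* r :* z := x :+ g :* (s :+ r) :* z)
             ≈-refl _ (-β ^ suc t) _ _ _ ⟩
      _ ∎

    -- Up to `-β ^ suc t`, the coefficient of `Z (y ∷ ν)` on the way from `Ψ ν y (suc t)` to
    -- `Ψ (y ∷ ν) m t`: the last term of the convolution, then the gain from raising `u` from `y` to
    -- `m`.
    W : ℕ → ℕ → ℕ → Carrier
    W y m t = α⁻¹ ^ y * bin y (ℤ.+ suc t) + ∫ (λ u → bin u (ℤ.+ t)) y (m ∸ y)

    -- Rows of length `y` on top of `y ∷ ν` are such rows on top of `ν`, one more in number. At
    -- `u = y` the two convolutions thus differ only by the last term, where `onTop ν y 1` is
    -- `Z (y ∷ ν)`.
    Ψ-∷ : ∀ y (ν : Vec ℕ k) m t → y ≤ m →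
      Ψ (y ∷ ν) m t + -β ^ suc t * W y m t * Z α β (y ∷ ν) ≈ Ψ ν y (suc t)
    Ψ-∷ y ν m t y≤m = ≈-sym (begin
      α⁻¹ ^ y * conv (suc t) (coef y) (onTop α β ν y ∘ suc)
        ≈⟨ *-congˡ (conv-last t (coef y) _) ⟩
      α⁻¹ ^ y * (conv t (coef y) (λ i → onTop α β ν y (suc (suc i))) + coef y (suc t) * Z α β (y ∷ ν))
        ≈⟨ *-congˡ (+-congʳ (conv-cong t (λ _ → ≈-refl)
             λ i → reflexive (≡.sym (onTop-head y ν (suc i))))) ⟩
      α⁻¹ ^ y * (conv t (coef y) (onTop α β (y ∷ ν) y ∘ suc) + coef y (suc t) * Z α β (y ∷ ν))
        ≈⟨ solve 5 (λ a r g b z → a :* (r :+ g :* b :* z) := a :* r :+ g :* (a :* b) :* z)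
             ≈-refl (α⁻¹ ^ y) _ (-β ^ suc t) _ _ ⟩
      Ψ (y ∷ ν) y t + -β ^ suc t * (α⁻¹ ^ y * bin y (ℤ.+ suc t)) * Z α β (y ∷ ν)
        ≈⟨ +-congʳ (Ψ-+ (y ∷ ν) y t ℕ.≤-refl (m ∸ y)) ⟩
      _ ≈⟨ solve 5 (λ x g s r z → x :+ g :* s :* z :+ g :* r :* z := x :+ g :* (r :+ s) :* z)
             ≈-refl _ (-β ^ suc t) _ _ _ ⟩
      Ψ (y ∷ ν) ((m ∸ y) ℕ.+ y) t + -β ^ suc t * W y m t * Z α β (y ∷ ν)
        ≡⟨ ≡.cong (λ n → Ψ (y ∷ ν) n t + -β ^ suc t * W y m t * Z α β (y ∷ ν)) (ℕ.m∸n+n≡m y≤m) ⟩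
      Ψ (y ∷ ν) m t + -β ^ suc t * W y m t * Z α β (y ∷ ν) ∎)

    -- α^λ₁ (row₀ + rowβ 0 λ₁) is the first row of A for the partition λ₁ ∷ μ: rowβ
    -- collects the binomials that come with a factor β, row₀ the other ones, which
    -- past the first entry are those of rowβ for the tail of μ.
    rowβ : ℕ → ℕ → Vec ℕ k → Fin (suc k) → Carrier
    rowβ t m μ       zero    = β ^ suc t * W (part μ 0) m t
    rowβ t m (y ∷ ν) (suc j) = rowβ (suc t) y ν j

    sign*rowβ : ∀ t x z → (- 1#) ^ suc t * (β ^ suc t * x * z) ≈ -β ^ suc t * x * z
    sign*rowβ t x z = ≈-trans
      (solve 4 (λ e b x z → e :* (b :* x :* z) := e :* b :* x :* z) ≈-refl _ _ x z)
      (*-congʳ (*-congʳ (≈-sym (^-distrib-* (- 1#) β (suc t)))))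

    conv-coef-0 : ∀ t → conv t (coef 0) (λ _ → 1#) ≈ 1#
    conv-coef-0 zero    = solve 0 (con 1 :* (con 1 :+ con 0) :* con 1 := con 1) ≈-refl
    conv-coef-0 (suc t) = begin
      conv (suc t) (coef 0) (λ _ → 1#)
        ≈⟨ conv-last t (coef 0) _ ⟩
      conv t (coef 0) (λ _ → 1#) + -β ^ suc t * 0# * 1#
        ≈⟨ +-congʳ (conv-coef-0 t) ⟩
      1# + -β ^ suc t * 0# * 1#
        ≈⟨ solve 1 (λ g → con 1 :+ g :* con 0 :* con 1 := con 1) ≈-refl (-β ^ suc t) ⟩
      1# ∎

    -- Iterates `Ψ-∷`: part after part joins the rows on top while `u` falls, until the empty
    -- partition at `u = 0` gives 1. The signs in the powers of -β are the alternating signs of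
    -- `expand`.
    Ψ-expand : ∀ {μ : Vec ℕ k} → Linked _≥_ μ → ∀ m t → part μ 0 ≤ m →
      Ψ μ m t + (- 1#) ^ suc t * expand (Z α β) μ (rowβ t m μ) ≈ 1#
    Ψ-expand {μ = []} _ m t _ = begin
      Ψ [] m t + (- 1#) ^ suc t * (β ^ suc t * W 0 m t)
        ≈⟨ +-congˡ (*-congˡ (*-identityʳ _)) ⟨
      Ψ [] m t + (- 1#) ^ suc t * (β ^ suc t * W 0 m t * 1#)
        ≈⟨ +-congˡ (sign*rowβ t _ _) ⟩
      Ψ [] m t + -β ^ suc t * W 0 m t * 1#
        -- The binomial in `W 0` vanishes because `suc t` exceeds 0; only the integral is left.
        ≈⟨ solve 4 (λ p g s z → p :+ g :* (con 1 :* con 0 :+ s) :* z := p :+ g :* s :* z)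
             ≈-refl _ (-β ^ suc t) _ _ ⟩
      Ψ [] m t + -β ^ suc t * ∫ (λ u → bin u (ℤ.+ t)) 0 m * 1#
        ≡⟨ ≡.cong (λ n → Ψ [] n t + -β ^ suc t * ∫ (λ u → bin u (ℤ.+ t)) 0 m * 1#)
             (ℕ.+-identityʳ m) ⟨
      Ψ [] (m ℕ.+ 0) t + -β ^ suc t * ∫ (λ u → bin u (ℤ.+ t)) 0 m * 1#
        ≈⟨ Ψ-+ [] 0 t z≤n m ⟨
      Ψ [] 0 t
        ≈⟨ ≈-trans (*-identityˡ _) (conv-coef-0 t) ⟩
      1# ∎
    Ψ-expand {μ = y ∷ ν} ls m t y≤m = begin
      Ψ (y ∷ ν) m t + (- 1#) ^ suc t * (β ^ suc t * W y m t * Z α β (y ∷ ν)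
        + - 1# * expand (Z α β) ν (rowβ (suc t) y ν))
        ≈⟨ solve 5 (λ p s x e r → p :+ s :* (x :+ e :* r) := p :+ s :* x :+ e :* s :* r)
             ≈-refl _ ((- 1#) ^ suc t) _ (- 1#) _ ⟩
      _ ≈⟨ +-congʳ (+-congˡ (sign*rowβ t _ _)) ⟩
      _ ≈⟨ +-congʳ (Ψ-∷ y ν m t y≤m) ⟩
      Ψ ν y (suc t) + (- 1#) ^ suc (suc t) * expand (Z α β) ν (rowβ (suc t) y ν)
        ≈⟨ Ψ-expand (Linked.tail ls) y (suc t) (head-≥ ls) ⟩
      1# ∎

    -- The first row of A

    ∫-linear : ∀ f g b y d → ∫ (λ u → f u + b * g u) y d ≈ ∫ f y d + b * ∫ g y d
    ∫-linear f g b y zero    = solve 1 (λ b → con 0 := con 0 :+ b :* con 0) ≈-refl b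
    ∫-linear f g b y (suc d) = ≈-trans (+-congˡ (∫-linear f g b y d))
      (solve 6 (λ a x z b p q → a :* (x :+ b :* z) :+ (p :+ b :* q)
          := a :* x :+ p :+ b :* (a :* z :+ q)) ≈-refl _ _ _ b _ _)

    ∫-0 : ∀ y d → ∫ (λ _ → 0#) y d ≈ 0#
    ∫-0 y zero    = ≈-refl
    ∫-0 y (suc d) = ≈-trans (+-congʳ (zeroʳ _)) (≈-trans (+-identityˡ _) (∫-0 y d))

    -- The inner sum of `A` runs downwards through `u = d + y - l - 1`, where
    -- `α⁻¹ ^ (d + y) * α ^ l` is `α⁻¹ ^ suc u`.
    ∫-sum : ∀ f y d →
      α⁻¹ ^ (d ℕ.+ y) * sum {d} (λ l → α ^ toℕ l * f (d ℕ.+ y ∸ toℕ l ∸ 1)) ≈ ∫ f y d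
    ∫-sum f y zero    = zeroʳ _
    ∫-sum f y (suc d) = begin
      α⁻¹ * a * (1# * f (d ℕ.+ y) + sum {d} (λ l → α * α ^ toℕ l * F l))
        ≈⟨ *-congˡ (+-congˡ (sum-cong-≋ {d} λ l → *-assoc α _ _)) ⟩
      α⁻¹ * a * (1# * f (d ℕ.+ y) + sum {d} (λ l → α * (α ^ toℕ l * F l)))
        ≈⟨ *-congˡ (+-congˡ (*-distribˡ-sum {d} α _)) ⟨
      α⁻¹ * a * (1# * f (d ℕ.+ y) + α * sum {d} (λ l → α ^ toℕ l * F l))
        ≈⟨ solve 5 (λ i a x c s → i :* a :* (con 1 :* x :+ c :* s) := i :* a :* x :+ i :* c :* (a :* s))
             ≈-refl α⁻¹ a _ α _ ⟩
      α⁻¹ * a * f (d ℕ.+ y) + α⁻¹ * α * (a * sum {d} (λ l → α ^ toℕ l * F l))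
        ≈⟨ +-congˡ (≈-trans (*-congʳ (proj₁ (proj₂ α-unit))) (*-identityˡ _)) ⟩
      α⁻¹ * a * f (d ℕ.+ y) + a * sum {d} (λ l → α ^ toℕ l * F l)
        ≈⟨ +-congˡ (∫-sum f y d) ⟩
      ∫ f y (suc d) ∎
      where
      a = α⁻¹ ^ (d ℕ.+ y)
      F : Fin d → Carrier
      F l = f (d ℕ.+ y ∸ toℕ l ∸ 1)

    α^*α⁻¹^ : ∀ n → α ^ n * α⁻¹ ^ n ≈ 1#
    α^*α⁻¹^ zero    = *-identityˡ 1#
    α^*α⁻¹^ (suc n) = begin
      α * α ^ n * (α⁻¹ * α⁻¹ ^ n)
        ≈⟨ solve 4 (λ a x i y → a :* x :* (i :* y) := i :* a :* (x :* y)) ≈-refl α _ α⁻¹ _ ⟩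
      α⁻¹ * α * (α ^ n * α⁻¹ ^ n)
        ≈⟨ *-cong (proj₁ (proj₂ α-unit)) (α^*α⁻¹^ n) ⟩
      1# * 1#
        ≈⟨ *-identityˡ 1# ⟩
      1# ∎

    zpow-⊖ : ∀ {p q} → q ≤ p → zpow α-unit (p ⊖ q) ≈ α ^ p * α⁻¹ ^ q
    zpow-⊖ {p} {q} q≤p rewrite ℤ.⊖-≥ q≤p = begin
      α ^ (p ∸ q)
        ≈⟨ *-identityʳ _ ⟨
      α ^ (p ∸ q) * 1#
        ≈⟨ *-congˡ (α^*α⁻¹^ q) ⟨
      α ^ (p ∸ q) * (α ^ q * α⁻¹ ^ q)
        ≈⟨ *-assoc _ _ _ ⟨
      α ^ (p ∸ q) * α ^ q * α⁻¹ ^ q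
        ≈⟨ *-congʳ (^-homo-* α (p ∸ q) q) ⟨
      α ^ ((p ∸ q) ℕ.+ q) * α⁻¹ ^ q
        ≡⟨ ≡.cong (λ n → α ^ n * α⁻¹ ^ q) (ℕ.m∸n+n≡m q≤p) ⟩
      α ^ p * α⁻¹ ^ q ∎

    part-antitone : ∀ {μ : Vec ℕ k} → Linked _≥_ μ → ∀ j → part μ (suc j) ≤ part μ j
    part-antitone []          j       = z≤n
    part-antitone [-]         j       = z≤n
    part-antitone ls@(_ ∷ _)  zero    = head-≥ ls
    part-antitone (_ ∷ ls)    (suc j) = part-antitone ls j

    part≤head : ∀ {μ : Vec ℕ k} → Linked _≥_ μ → ∀ j → part μ j ≤ part μ 0
    part≤head ls zero    = ℕ.≤-refl
    part≤head ls (suc j) = ℕ.≤-trans (part-antitone ls j) (part≤head ls j)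

    rowβ-toℕ : ∀ t m (μ : Vec ℕ k) j →
      rowβ t m μ j ≡ β ^ suc (t ℕ.+ toℕ j) * W (part μ (toℕ j)) (part (m ∷ μ) (toℕ j)) (t ℕ.+ toℕ j)
    rowβ-toℕ t m μ       zero    rewrite ℕ.+-identityʳ t = refl
    rowβ-toℕ t m (y ∷ ν) (suc j) rewrite ℕ.+-suc t (toℕ j) = rowβ-toℕ (suc t) y ν j

    row₀ : Vec ℕ k → Fin (suc k) → Carrier
    row₀ μ       zero    = α⁻¹ ^ part μ 0
    row₀ (y ∷ ν) (suc j) = rowβ 0 y ν j

    -- The exponents λ₁ - λⱼ are natural numbers, so α^λ₁ can be taken out. In column `suc j` the
    -- terms without the explicit β have the power of β and the lower indices that the terms with it
    -- have in column `j`, so `rowβ` describes both.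
    A-first-row : ∀ {x} {μ : Vec ℕ k} → Linked _≥_ (x ∷ μ) → ∀ j →
      A (x ∷ μ) α-unit β-unit zero j ≈ α ^ x * (row₀ μ j + rowβ 0 x μ j)
    A-first-row {x = x} {μ} ls j = begin
      B * zpow α-unit (x ⊖ y) * (bin y (ℤ.+ J) + β * bin y (ℤ.+ suc J))
        + B * zpow α-unit (x ⊖ z) * sum {z ∸ y} (λ l → α ^ toℕ l * f (z ∸ toℕ l ∸ 1))
        ≈⟨ +-cong (*-congʳ (*-congˡ (zpow-⊖ (part≤head ls (suc J)))))
             (*-congʳ (*-congˡ (zpow-⊖ (part≤head ls J)))) ⟩
      B * (α ^ x * α⁻¹ ^ y) * (bin y (ℤ.+ J) + β * bin y (ℤ.+ suc J))
        + B * (α ^ x * α⁻¹ ^ z) * sum {z ∸ y} (λ l → α ^ toℕ l * f (z ∸ toℕ l ∸ 1))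
        ≈⟨ solve 8 (λ B a i c b c′ i′ s → B :* (a :* i) :* (c :+ b :* c′) :+ B :* (a :* i′) :* s
             := a :* (B :* (i :* c :+ b :* (i :* c′) :+ i′ :* s))) ≈-refl B _ _ _ β _ _ _ ⟩
      α ^ x * (B * (α⁻¹ ^ y * bin y (ℤ.+ J) + β * (α⁻¹ ^ y * bin y (ℤ.+ suc J))
        + α⁻¹ ^ z * sum {z ∸ y} (λ l → α ^ toℕ l * f (z ∸ toℕ l ∸ 1))))
        ≈⟨ *-congˡ (*-congˡ (+-congˡ inner)) ⟩
      α ^ x * (B * (α⁻¹ ^ y * bin y (ℤ.+ J) + β * (α⁻¹ ^ y * bin y (ℤ.+ suc J))
        + (∫ f₁ y (z ∸ y) + β * ∫ f₂ y (z ∸ y))))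
        ≈⟨ *-congˡ (solve 6 (λ B p b q r s → B :* (p :+ b :* q :+ (r :+ b :* s))
             := B :* (p :+ r) :+ b :* B :* (q :+ s)) ≈-refl B _ β _ _ _) ⟩
      α ^ x * (B * (α⁻¹ ^ y * bin y (ℤ.+ J) + ∫ f₁ y (z ∸ y)) + β * B * W y z J)
        ≈⟨ *-congˡ (+-cong (first μ j) (reflexive (≡.sym (rowβ-toℕ 0 x μ j)))) ⟩
      α ^ x * (row₀ μ j + rowβ 0 x μ j) ∎
      where
      J = toℕ j
      z = part (x ∷ μ) J
      y = part μ J
      B = β ^ J
      f₁ f₂ f : ℕ → Carrier
      f₁ u = bin u (ℤ.pred (ℤ.+ J))
      f₂ u = bin u (ℤ.+ J)
      f u = f₁ u + β * f₂ u

      inner : α⁻¹ ^ z * sum {z ∸ y} (λ l → α ^ toℕ l * f (z ∸ toℕ l ∸ 1))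
        ≈ ∫ f₁ y (z ∸ y) + β * ∫ f₂ y (z ∸ y)
      inner = begin
        α⁻¹ ^ z * sum {z ∸ y} (λ l → α ^ toℕ l * f (z ∸ toℕ l ∸ 1))
          ≡⟨ ≡.cong (λ n → α⁻¹ ^ n * sum {z ∸ y} (λ l → α ^ toℕ l * f (n ∸ toℕ l ∸ 1)))
               (ℕ.m∸n+n≡m (part-antitone ls J)) ⟨
        _ ≈⟨ ∫-sum f y (z ∸ y) ⟩
        ∫ f y (z ∸ y)
          ≈⟨ ∫-linear f₁ f₂ β y (z ∸ y) ⟩
        ∫ f₁ y (z ∸ y) + β * ∫ f₂ y (z ∸ y) ∎

      first : ∀ (μ : Vec ℕ k) j → let y = part μ (toℕ j); z = part (x ∷ μ) (toℕ j) in
        β ^ toℕ j * (α⁻¹ ^ y * bin y (ℤ.+ toℕ j) + ∫ (λ u → bin u (ℤ.pred (ℤ.+ toℕ j))) y (z ∸ y))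
          ≈ row₀ μ j
      -- In the first column the integral has lower index -1 and vanishes.
      first μ       zero    = ≈-trans
        (*-congˡ (+-cong (*-congˡ (bin-0 (part μ 0))) (∫-0 (part μ 0) (x ∸ part μ 0))))
        (solve 1 (λ a → con 1 :* (a :* con 1 :+ con 0) := a) ≈-refl _)
      first (y ∷ ν) (suc j) = reflexive (≡.sym (rowβ-toℕ 0 y ν j))

    -- Comparison of the two recursions

    Ψ-0 : ∀ (μ : Vec ℕ k) m → Ψ μ m 0 ≈ α⁻¹ ^ m * onTop α β μ m 1
    Ψ-0 μ m = *-congˡ (≈-trans (*-congʳ (≈-trans (*-identityˡ _) (bin-0 m))) (*-identityˡ _))

    -- At `t = 0` the convolution has a single term, and `onTop μ m 1` is `Z (m ∷ μ)`; the expansion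
    -- thus computes `Z` after a new first part `m` is added.
    Ψ-expand-0 : ∀ {μ : Vec ℕ k} → Linked _≥_ μ → ∀ m → part μ 0 ≤ m →
      α⁻¹ ^ m * onTop α β μ m 1 + - 1# * expand (Z α β) μ (rowβ 0 m μ) ≈ 1#
    Ψ-expand-0 {μ = μ} ls m μ≤m = ≈-trans
      (+-cong (≈-sym (Ψ-0 μ m)) (*-congʳ (≈-sym (*-identityʳ _)))) (Ψ-expand ls m 0 μ≤m)

    -- Expanding `row₀` along `y ∷ ν` gives the left side of `Ψ-expand-0` for `ν` and `m = y`.
    expand-row₀ : ∀ {μ : Vec ℕ k} → Linked _≥_ μ → expand (Z α β) μ (row₀ μ) ≈ 1#
    expand-row₀ {μ = []}    ls = ≈-refl
    expand-row₀ {μ = y ∷ ν} ls = Ψ-expand-0 (Linked.tail ls) y (head-≥ ls)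

    Z-expand : ∀ {x} {μ : Vec ℕ k} → Linked _≥_ (x ∷ μ) →
      expand (Z α β) μ (A (x ∷ μ) α-unit β-unit zero) ≈ Z α β (x ∷ μ)
    Z-expand {x = x} {μ} ls = begin
      expand (Z α β) μ (A (x ∷ μ) α-unit β-unit zero)
        ≈⟨ expand-cong (Z α β) μ (A-first-row ls) ⟩
      _ ≈⟨ expand-linear (Z α β) μ (α ^ x) (row₀ μ) (rowβ 0 x μ) ⟩
      α ^ x * (expand (Z α β) μ (row₀ μ) + E)
        -- The 1 that `row₀` contributes is rewritten by `Ψ-expand-0` with `m = x`, which brings in
        -- `Z (x ∷ μ)` and a negative `E` to cancel the other one.
        ≈⟨ *-congˡ (+-congʳ (≈-trans (expand-row₀ (Linked.tail ls))
             (≈-sym (Ψ-expand-0 (Linked.tail ls) x (head-≥ ls))))) ⟩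
      α ^ x * (α⁻¹ ^ x * Z α β (x ∷ μ) + - 1# * E + E)
        ≈⟨ solve 5 (λ a i z e E → a :* (i :* z :+ e :* E :+ E) := a :* i :* z :+ a :* (E :+ e :* E))
             ≈-refl _ _ _ (- 1#) E ⟩
      α ^ x * α⁻¹ ^ x * Z α β (x ∷ μ) + α ^ x * (E + - 1# * E)
        ≈⟨ +-cong (*-congʳ (α^*α⁻¹^ x)) (*-congˡ (cancel E)) ⟩
      1# * Z α β (x ∷ μ) + α ^ x * 0#
        ≈⟨ solve 2 (λ z a → con 1 :* z :+ a :* con 0 := z) ≈-refl _ _ ⟩
      Z α β (x ∷ μ) ∎
      where E = expand (Z α β) μ (rowβ 0 x μ)

    mutual

      -- `det-A` and `Z-expand` are the same recursion. It refers to every tail of the partition,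
      -- hence the simultaneous induction on whole expansions.
      detA≈Z : ∀ {μ : Vec ℕ k} → Linked _≥_ μ → detA μ ≈ Z α β μ
      detA≈Z {μ = []}    ls = ≈-refl
      detA≈Z {μ = x ∷ μ} ls = ≈-trans (det-A x μ)
        (≈-trans (expand-detA≈Z (Linked.tail ls) _) (Z-expand ls))

      expand-detA≈Z : ∀ {μ : Vec ℕ k} → Linked _≥_ μ → ∀ v →
        expand detA μ v ≈ expand (Z α β) μ v
      expand-detA≈Z {μ = []}    ls v = ≈-refl
      expand-detA≈Z {μ = y ∷ ν} ls v =
        +-cong (*-congˡ (detA≈Z ls)) (*-congˡ (expand-detA≈Z (Linked.tail ls) (v ∘ suc)))

theorem5p1 : ∀ {c ℓ} (R : CommutativeRing c ℓ) →
    let open CommutativeRing R in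
    let open Over R in
    (α β : Carrier) (α-unit : Unit α) (β-unit : Unit β) →
    (n k : ℕ) → n ≥ k → k ≥ 1 →
    (μ : Vec ℕ k) → Linked _≥_ μ → part μ 0 ≤ n ∸ k →
    P n μ α β ≈ α ^ k * β ^ (n ∸ k) * det (A μ α-unit β-unit)
theorem5p1 R α β α-unit β-unit n k _ _ μ ls _ =
  trans (P≈Z R α β n ls) (*-congˡ (sym (detA≈Z R α-unit β-unit ls)))
  where open CommutativeRing R
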